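{- $m(3)=10$; that is, the smallest number of edges of a minimal uncolorable $3$-uniform bi-hypergraph is $10$.
   Context: A bi-hypergraph is a pair $\mathcal{H}=(\mathcal{V},\mathcal{E})$ with $\mathcal{V}$ a finite set and $\mathcal{E}$ a Sperner family of subsets of $\mathcal{V}$ (edges); it is $r$-uniform if all edges have size $r$. A proper coloring is a map $f:\mathcal{V}\to\mathbb{N}$ with $1<|\{f(v):v\in e\}|<|e|$ for every edge $e$; $\mathcal{H}$ is colorable if such $f$ exists. A subhypergraph is $(\mathcal{V}',\mathcal{E}')$ with $\mathcal{V}'\subseteq\mathcal{V}$, $\mathcal{E}'\subseteq\mathcal{E}$. $\mathcal{H}$ is minimal uncolorable if it is uncolorable but every proper subhypergraph is colorable. $m(r)$ denotes the smallest positive integer $m$ such that there exists a minimal uncolorable $r$-uniform bi-hypergraph with $m$ edges. -}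

module Defs where

open import Data.Nat using (ℕ; _<_)
open import Data.Nat.Properties using (_≟_)
open import Data.Fin using (Fin)
open import Data.Fin.Subset using (Subset; _∈_; _⊆_; ∣_∣)
open import Data.Fin.Subset.Properties using (_∈?_)
open import Data.List using (List; filter; map; length; deduplicate; allFin)
import Data.List.Membership.Propositional as L
open import Data.List.Relation.Unary.Unique.Propositional using (Unique)
open import Data.Product using (Σ; _×_)
open import Relation.Binary.PropositionalEquality using (_≡_)
open import Relation.Nullary using (¬_)

-- The vertices of a hypergraph live in an ambient finite set Fin n;
-- the vertex set is a subset V ⊆ Fin n (so every finite vertex set is covered).
-- The edge family is a duplicate-free list of subsets of V.

elems : ∀ {n} → Subset n → List (Fin n)
elems p = filter (_∈? p) (allFin _)

colours : ∀ {n} → (Fin n → ℕ) → Subset n → ℕ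
colours f e = length (deduplicate _≟_ (map f (elems e)))

record PreHypergraph (n : ℕ) : Set where
  constructor mkPre
  field
    V : Subset n
    E : List (Subset n)
    E-unique : Unique E
    E⊆V : ∀ {e} → e L.∈ E → e ⊆ V

open PreHypergraph public

Sperner : ∀ {n} → List (Subset n) → Set
Sperner E = ∀ {e e′} → e L.∈ E → e′ L.∈ E → e ⊆ e′ → e ≡ e′

record BiHypergraph (n : ℕ) : Set where
  constructor mkBi
  field
    pre : PreHypergraph n
    sperner : Sperner (E pre)

open BiHypergraph public

numEdges : ∀ {n} → BiHypergraph n → ℕ
numEdges H = length (E (pre H))

Uniform : ∀ {n} → ℕ → BiHypergraph n → Set
Uniform r H = ∀ {e} → e L.∈ E (pre H) → ∣ e ∣ ≡ r

ProperColouring : ∀ {n} → List (Subset n) → (Fin n → ℕ) → Set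
ProperColouring E f = ∀ {e} → e L.∈ E → (1 < colours f e) × (colours f e < ∣ e ∣)

ColourablePre : ∀ {n} → PreHypergraph n → Set
ColourablePre H = Σ (Fin _ → ℕ) λ f → ProperColouring (E H) f

Colourable : ∀ {n} → BiHypergraph n → Set
Colourable H = ColourablePre (pre H)

-- H′ is a subhypergraph of H: V′ ⊆ V and E′ ⊆ E
-- (a subfamily of a Sperner family is Sperner, so H′ is again a bi-hypergraph)
SubHypergraph : ∀ {n} → PreHypergraph n → PreHypergraph n → Set
SubHypergraph H′ H = (V H′ ⊆ V H) × (∀ {e} → e L.∈ E H′ → e L.∈ E H)

-- H′ is different from H (given H′ is a subhypergraph: V ⊄ V′ or E ⊄ E′)
Proper : ∀ {n} → PreHypergraph n → PreHypergraph n → Set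
Proper H′ H = ¬ ((V H ⊆ V H′) × (∀ {e} → e L.∈ E H → e L.∈ E H′))

MinimalUncolourable : ∀ {n} → BiHypergraph n → Set
MinimalUncolourable H =
  ¬ Colourable H ×
  (∀ (H′ : PreHypergraph _) → SubHypergraph H′ (pre H) → Proper H′ (pre H) → ColourablePre H′)

{-# OPTIONS --safe #-}

-- The extremal hypergraph is the complete one on five vertices.  For the lower
-- bound, k colourings such that every edge is bad for at most one of them
-- cannot all be blocked by fewer than k edges.
-- On at most six vertices take the ten balanced 2-colourings.  On seven or more
-- vertices some v lies on at most three edges, since 9 · 3 < 7 · 4.  If some
-- w ≠ v shares no edge with v, identify w with v and induct.  Otherwise there are
-- exactly seven vertices and the edges at v are v a a′, v b b′, v c c′; seven
-- colourings suit these three edges, and every other triple is bad for at most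
-- one of the seven, so the remaining at most six edges leave one of them proper.
module Submission where

open import Defs
open import Data.Nat using (ℕ; zero; suc; _+_; _*_; _<_; _≤_; z≤n; s≤s; s≤s⁻¹)
open import Data.Product using (Σ; _×_; _,_; ∃; proj₁; proj₂)
open import Relation.Binary.PropositionalEquality using (_≡_; _≢_; refl; sym; trans; cong; subst)

open import Algebra.Properties.CommutativeMonoid.Sum using (∑-comm; ∑-distrib-+; sum-replicate-zero)
open import Data.Bool using (Bool; true; false; if_then_else_)
open import Data.Fin using (Fin; zero; suc; punchIn; punchOut; combine; remQuot; inject≤)
open import Data.Fin.Patterns using (0F; 1F; 2F)
open import Data.Fin.Properties using (any?; all?; pigeonhole; injective⇒≤; punchOut-injective; punchIn-punchOut; remQuot-combine; inject≤-injective; <⇒≢; <-cmp)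
open import Data.Fin.Subset using (Subset; inside; outside; ⊥; ⊤; _⊆_; ∣_∣) renaming (_∈_ to _∈ˢ_)
open import Data.Fin.Subset.Properties using (_∈?_; _⊆?_; anySubset?; drop-there; ⊆⊤)
open import Data.List using (List; []; _∷_; _++_; length; filter; map; lookup; deduplicate)
open import Data.List.Membership.Propositional using (_∈_; find; lose; mapWith∈)
open import Data.List.Membership.Propositional.Properties using (∈-filter⁺; ∈-filter⁻; ∈-lookup; ∈-map⁻)
open import Data.List.Membership.Setoid.Properties using (length-mapWith∈)
open import Data.List.Properties using (length-map)
open import Data.List.Relation.Unary.All using (All; []; _∷_)
open import Data.List.Relation.Unary.Any using (Any; here; there; index)
open import Data.List.Relation.Unary.Any.Properties using (lookup-index; mapWith∈⁺; mapWith∈⁻)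
open import Data.List.Relation.Unary.AllPairs using ([]; _∷_)
open import Data.List.Relation.Unary.Unique.DecPropositional using (unique?)
open import Data.List.Relation.Unary.Unique.Propositional using (Unique)
open import Data.List.Relation.Unary.Unique.Propositional.Properties using (filter⁺; allFin⁺)
open import Data.Sum using (_⊎_; inj₁; inj₂)
open import Data.Vec using (Vec; []; _∷_; here; there)
open import Data.Vec.Properties using (≡-dec; lookup∘tabulate)
open import Function using (_∘_; id)
open import Function.Definitions using (Injective)
open import Relation.Binary.Definitions using (DecidableEquality; tri<; tri≈; tri>)
open import Relation.Nullary using (¬_; Dec; yes; no; does; contradiction)
open import Relation.Nullary.Decidable using (_×-dec_; _⊎-dec_; _→-dec_; ¬?; from-yes; from-no; decidable-stable)
import Data.Bool as Bool
import Data.Fin as Fin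
import Data.List as List
import Data.List.Properties as List
import Data.List.Relation.Unary.All as All
import Data.List.Relation.Unary.All.Properties as All
import Data.List.Relation.Unary.Any as Any
import Data.Nat
import Data.Nat.Properties as ℕ
import Data.Vec as Vec
import Relation.Binary.PropositionalEquality as ≡

open import Algebra.Definitions.RawMonoid Data.Nat.+-0-rawMonoid using (sum)

-- Two-coloured triples and the pigeonhole on colourings

Bicoloured : {A : Set} → A → A → A → Set
Bicoloured a b c = (a ≢ b ⊎ a ≢ c) × (a ≡ b ⊎ a ≡ c ⊎ b ≡ c)

bicoloured? : ∀ a b c → Dec (Bicoloured a b c)
bicoloured? a b c =
  (¬? (a ℕ.≟ b) ⊎-dec ¬? (a ℕ.≟ c)) ×-dec (a ℕ.≟ b ⊎-dec a ℕ.≟ c ⊎-dec b ℕ.≟ c)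

-- Edges are functions so that a vertex map acts by composition. Distinctness of the corners is the
-- separate condition `Inj`, which merging vertices could break.
Triple : ℕ → Set
Triple n = Fin 3 → Fin n

Inj : ∀ {m n} → (Fin m → Fin n) → Set
Inj = Injective _≡_ _≡_

BicolouredOn : ∀ {n} → (Fin n → ℕ) → Triple n → Set
BicolouredOn f t = Bicoloured (f (t 0F)) (f (t 1F)) (f (t 2F))

bicolouredOn? : ∀ {n} (f : Fin n → ℕ) t → Dec (BicolouredOn f t)
bicolouredOn? f t = bicoloured? _ _ _

bicolouredOn-resp : ∀ {m n} (f : Fin n → ℕ) {g : Fin m → Fin n} {t : Triple m} {u : Triple n} →
  (∀ j → g (t j) ≡ u j) → BicolouredOn f u → BicolouredOn (f ∘ g) t
bicolouredOn-resp f eq good rewrite eq 0F | eq 1F | eq 2F = good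

HasBicolouring : ∀ {n} → List (Triple n) → Set
HasBicolouring {n} E = Σ (Fin n → ℕ) λ f → All (BicolouredOn f) E

-- If every colouring had a bad triple, picking the position of one for each would map `m`
-- colourings to fewer positions, so two would share a bad triple, against the separation
-- hypothesis.
pigeonhole-colouring : ∀ {n m} (c : Fin m → Fin n → ℕ) (E : List (Triple n)) → length E < m →
  (∀ {t} → t ∈ E → ∀ {k l} → k ≢ l → BicolouredOn (c k) t ⊎ BicolouredOn (c l) t) →
  ∃ λ k → All (BicolouredOn (c k)) E
pigeonhole-colouring c E E<m sep with any? (λ k → All.all? (bicolouredOn? (c k)) E)
... | yes found = found
... | no none = contradiction (pigeonhole E<m (index ∘ bad)) clash
  where
  bad : ∀ k → Any (¬_ ∘ BicolouredOn (c k)) E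
  bad k = All.¬All⇒Any¬ (bicolouredOn? (c k)) E (none ∘ (k ,_))
  clash : ¬ (∃ λ k → ∃ λ l → k Fin.< l × index (bad k) ≡ index (bad l))
  clash (k , l , k<l , eq) with sep (∈-lookup (index (bad k))) (<⇒≢ k<l)
  ... | inj₁ good = lookup-index (bad k) good
  ... | inj₂ good =
    lookup-index (bad l) (subst (λ i → BicolouredOn (c l) (lookup E i)) eq good)

-- Explicit families of colourings

balanced : Fin 10 → Fin 6 → ℕ
balanced k i = Vec.lookup (Vec.lookup table k) i
  where
  table : Vec (Vec ℕ 6) 10
  table = (0 ∷ 0 ∷ 0 ∷ 1 ∷ 1 ∷ 1 ∷ [])
        ∷ (0 ∷ 0 ∷ 1 ∷ 0 ∷ 1 ∷ 1 ∷ [])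
        ∷ (0 ∷ 0 ∷ 1 ∷ 1 ∷ 0 ∷ 1 ∷ [])
        ∷ (0 ∷ 0 ∷ 1 ∷ 1 ∷ 1 ∷ 0 ∷ [])
        ∷ (0 ∷ 1 ∷ 0 ∷ 0 ∷ 1 ∷ 1 ∷ [])
        ∷ (0 ∷ 1 ∷ 0 ∷ 1 ∷ 0 ∷ 1 ∷ [])
        ∷ (0 ∷ 1 ∷ 0 ∷ 1 ∷ 1 ∷ 0 ∷ [])
        ∷ (0 ∷ 1 ∷ 1 ∷ 0 ∷ 0 ∷ 1 ∷ [])
        ∷ (0 ∷ 1 ∷ 1 ∷ 0 ∷ 1 ∷ 0 ∷ [])
        ∷ (0 ∷ 1 ∷ 1 ∷ 1 ∷ 0 ∷ 0 ∷ [])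
        ∷ []

abstract
  -- With two colours a bad triple is monochromatic, hence one half of a 3+3 split of the six
  -- points, and a half determines its split. The search over all cases confirms this.
  balanced-separates : ∀ x y z → x ≢ y → x ≢ z → y ≢ z → ∀ k l → k ≢ l →
    Bicoloured (balanced k x) (balanced k y) (balanced k z) ⊎
    Bicoloured (balanced l x) (balanced l y) (balanced l z)
  balanced-separates = from-yes (all? λ x → all? λ y → all? λ z →
    ¬? (x Fin.≟ y) →-dec ¬? (x Fin.≟ z) →-dec ¬? (y Fin.≟ z) →-dec
    all? λ k → all? λ l → ¬? (k Fin.≟ l) →-dec
    (bicoloured? (balanced k x) (balanced k y) (balanced k z) ⊎-dec
     bicoloured? (balanced l x) (balanced l y) (balanced l z)))

-- The hub is 0 and the triples through it are {0,1,2}, {0,3,4}, {0,5,6}.  The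
-- first four colourings are bad only for triples meeting each of the pairs
-- {1,2}, {3,4}, {5,6}; the last three only for triples inside two of the pairs.
hubbed : Fin 7 → Fin 7 → ℕ
hubbed k i = Vec.lookup (Vec.lookup table k) i
  where
  table : Vec (Vec ℕ 7) 7
  table = (0 ∷ 0 ∷ 1 ∷ 0 ∷ 1 ∷ 0 ∷ 1 ∷ [])
        ∷ (0 ∷ 0 ∷ 1 ∷ 0 ∷ 1 ∷ 1 ∷ 0 ∷ [])
        ∷ (0 ∷ 0 ∷ 1 ∷ 1 ∷ 0 ∷ 0 ∷ 1 ∷ [])
        ∷ (0 ∷ 0 ∷ 1 ∷ 1 ∷ 0 ∷ 1 ∷ 0 ∷ [])
        ∷ (0 ∷ 2 ∷ 2 ∷ 1 ∷ 1 ∷ 1 ∷ 1 ∷ [])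
        ∷ (0 ∷ 1 ∷ 1 ∷ 2 ∷ 2 ∷ 1 ∷ 1 ∷ [])
        ∷ (0 ∷ 1 ∷ 1 ∷ 1 ∷ 1 ∷ 2 ∷ 2 ∷ [])
        ∷ []

abstract
  -- Off the hub each row uses only two colours, so bad means monochromatic. A transversal of the
  -- three pairs is a colour class in just one of the first four rows; a triple inside two pairs
  -- determines the third pair, hence one of the last three rows.
  hubbed-separates : ∀ x → x ≢ 0F → ∀ y → y ≢ 0F → ∀ z → z ≢ 0F → x ≢ y → x ≢ z → y ≢ z →
    ∀ k l → k ≢ l →
    Bicoloured (hubbed k x) (hubbed k y) (hubbed k z) ⊎
    Bicoloured (hubbed l x) (hubbed l y) (hubbed l z)
  hubbed-separates = from-yes (
    all? λ x → ¬? (x Fin.≟ 0F) →-dec all? λ y → ¬? (y Fin.≟ 0F) →-dec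
    all? λ z → ¬? (z Fin.≟ 0F) →-dec
    ¬? (x Fin.≟ y) →-dec ¬? (x Fin.≟ z) →-dec ¬? (y Fin.≟ z) →-dec
    all? λ k → all? λ l → ¬? (k Fin.≟ l) →-dec
    (bicoloured? (hubbed k x) (hubbed k y) (hubbed k z) ⊎-dec
     bicoloured? (hubbed l x) (hubbed l y) (hubbed l z)))

-- The j-th vertex of the k-th of d triples that share only a hub, the hub being
-- the i-th vertex of that triple.
spoke : ∀ {d} → Fin 3 → Fin d → Triple (suc (d * 2))
spoke i k j with i Fin.≟ j
... | yes _  = zero
... | no i≢j = suc (combine k (punchOut i≢j))

abstract
  hubbed-spokes : ∀ c i k → BicolouredOn (hubbed c) (spoke {3} i k)
  hubbed-spokes = from-yes (all? λ c → all? λ i → all? λ k → bicolouredOn? (hubbed c) (spoke {3} i k))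

-- Labelling the vertices around a hub

-- `φ` is injective because `s` undoes it. If it missed `x`, deleting `x` from its target would
-- inject `Fin n` into a set with fewer than `n` points. So `x` is some `φ w`, and then `s x` is
-- `w`.
section-inverse : ∀ {m n} → m ≤ n → (s : Fin m → Fin n) (φ : Fin n → Fin m) →
  (∀ w → s (φ w) ≡ w) → ∀ x → φ (s x) ≡ x
section-inverse {suc m} m<n s φ sφ x with any? (λ w → φ w Fin.≟ x)
... | yes (w , refl) = cong φ (sφ w)
... | no missed = contradiction (injective⇒≤ inj) (ℕ.<⇒≱ m<n)
  where
  x≢φ : ∀ w → x ≢ φ w
  x≢φ w eq = missed (w , sym eq)
  inj : Inj (λ w → punchOut (x≢φ w))
  inj {u} {w} eq = trans (sym (sφ u))
    (trans (cong s (punchOut-injective (x≢φ u) (x≢φ w) eq)) (sφ w))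

-- By `cov`, the map `s` from the `1 + 2d` abstract positions hits every vertex; choosing preimages
-- gives the injection. If also `1 + 2d ≤ n`, then `s` is a bijection, so the triples meet only in
-- the hub and are labelled exactly as spokes.
hub-labelling : ∀ {n d} (v : Fin n) (t : Fin d → Triple n) (p : Fin d → Fin 3) →
  (∀ k → t k (p k) ≡ v) → (∀ w → w ≢ v → ∃ λ k → ∃ λ j → t k j ≡ w) →
  Σ (Fin n → Fin (suc (d * 2))) λ φ → Inj φ × φ v ≡ zero ×
    (suc (d * 2) ≤ n → ∀ k j → φ (t k j) ≡ spoke (p k) k j)
hub-labelling {n} {d} v t p tp cov = proj₁ ∘ label , inj , label-v ,
  λ d≤n k j → trans (cong (proj₁ ∘ label) (sym (s-spoke k j)))
                    (section-inverse d≤n s (proj₁ ∘ label) (proj₂ ∘ label) (spoke (p k) k j))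
  where
  outer : Fin d × Fin 2 → Fin n
  outer (k , b) = t k (punchIn (p k) b)

  s : Fin (suc (d * 2)) → Fin n
  s zero    = v
  s (suc x) = outer (remQuot 2 x)

  s-spoke : ∀ k j → s (spoke (p k) k j) ≡ t k j
  s-spoke k j with p k Fin.≟ j
  ... | yes refl = sym (tp k)
  ... | no p≢j = trans (cong outer (remQuot-combine k (punchOut p≢j)))
                       (cong (t k) (punchIn-punchOut p≢j))

  label : ∀ w → ∃ λ x → s x ≡ w
  label w with w Fin.≟ v
  ... | yes refl = zero , refl
  ... | no w≢v with k , j , eq ← cov w w≢v = spoke (p k) k j , trans (s-spoke k j) eq

  label-v : proj₁ (label v) ≡ zero
  label-v with v Fin.≟ v
  ... | yes refl = refl
  ... | no v≢v = contradiction refl v≢v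

  inj : Inj (proj₁ ∘ label)
  inj {u} {w} eq = trans (sym (proj₂ (label u))) (trans (cong s eq) (proj₂ (label w)))

-- The injection gives `7 ≤ n ≤ 1 + 2d`, hence `3 ≤ d`, so the sharp case of `hub-labelling`
-- applies.
hub-labelling₇ : ∀ {n d} (v : Fin n) (t : Fin d → Triple n) (p : Fin d → Fin 3) →
  (∀ k → t k (p k) ≡ v) → (∀ w → w ≢ v → ∃ λ k → ∃ λ j → t k j ≡ w) → d ≤ 3 → 7 ≤ n →
  d ≡ 3 × Σ (Fin n → Fin 7) λ φ → Inj φ × φ v ≡ zero ×
    (∀ k → ∃ λ l → ∀ j → φ (t k j) ≡ spoke {3} (p k) l j)
hub-labelling₇ v t p tp cov d≤3 7≤n
  with φ , inj , φv , φt ← hub-labelling v t p tp cov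
  with refl ← ℕ.≤-antisym d≤3
    (ℕ.*-cancelʳ-≤ 3 _ 2 (s≤s⁻¹ (ℕ.≤-trans 7≤n (injective⇒≤ inj))))
  = refl , φ , inj , φv , λ k → k , φt 7≤n k

-- Colouring around a vertex that shares an edge with every other

infix 4 _∈ᵗ_ _∈ᵗ?_

_∈ᵗ_ : ∀ {n} → Fin n → Triple n → Set
v ∈ᵗ t = ∃ λ i → t i ≡ v

_∈ᵗ?_ : ∀ {n} (v : Fin n) t → Dec (v ∈ᵗ t)
v ∈ᵗ? t = any? λ i → t i Fin.≟ v

degree : ∀ {n} → Fin n → List (Triple n) → ℕ
degree v E = length (filter (v ∈ᵗ?_) E)

length-filter-¬ : ∀ {A : Set} {P : A → Set} (P? : ∀ x → Dec (P x)) xs →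
  length (filter (¬? ∘ P?) xs) + length (filter P? xs) ≡ length xs
length-filter-¬ P? [] = refl
length-filter-¬ P? (x ∷ xs) with does (P? x)
... | true  = trans (ℕ.+-suc _ _) (cong suc (length-filter-¬ P? xs))
... | false = cong suc (length-filter-¬ P? xs)

All-Inj : ∀ {n} → List (Triple n) → Set
All-Inj E = ∀ {t} → t ∈ E → Inj t

-- All seven relabelled `hubbed` colourings suit the triples at `v`, so the pigeonhole is applied
-- only to the triples avoiding `v`.
covered-colourable : ∀ {n} (E : List (Triple n)) → All-Inj E → length E ≤ 9 → 7 ≤ n →
  ∀ v → degree v E ≤ 3 → (∀ w → w ≢ v → Any (λ t → v ∈ᵗ t × w ∈ᵗ t) E) → HasBicolouring E
covered-colourable {n} E inj E≤9 7≤n v d≤3 cov =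
  let c , good = pigeonhole-colouring (λ k → hubbed k ∘ φ) rest rest<7 sep in
  hubbed c ∘ φ , All.filter⁻ (v ∈ᵗ?_) (All.tabulate (good-star c)) good
  where
  star rest : List (Triple n)
  star = filter (v ∈ᵗ?_) E
  rest = filter (¬? ∘ (v ∈ᵗ?_)) E

  hub : ∀ k → v ∈ᵗ lookup star k
  hub k = proj₂ (∈-filter⁻ (v ∈ᵗ?_) {xs = E} (∈-lookup k))

  reach : ∀ w → w ≢ v → ∃ λ k → ∃ λ j → lookup star k j ≡ w
  reach w w≢v with t , t∈E , v∈t , j , eq ← find (cov w w≢v) =
    let t∈star = ∈-filter⁺ (v ∈ᵗ?_) t∈E v∈t in
    index t∈star , j , trans (cong (λ u → u j) (sym (lookup-index t∈star))) eq

  labelling = hub-labelling₇ v (lookup star) (proj₁ ∘ hub) (proj₂ ∘ hub) reach d≤3 7≤n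
  φ = proj₁ (proj₂ labelling)
  φ-inj = proj₁ (proj₂ (proj₂ labelling))
  φv = proj₁ (proj₂ (proj₂ (proj₂ labelling)))
  φ-star = proj₂ (proj₂ (proj₂ (proj₂ labelling)))

  rest<7 : length rest < 7
  -- The star has three triples, so `length rest + 3 ≤ 9`; the outer `s≤s` makes the bound strict.
  rest<7 = ℕ.+-cancelʳ-≤ 3 _ 7 (s≤s (ℕ.≤-trans (ℕ.≤-reflexive
    (trans (cong (length rest +_) (sym (proj₁ labelling))) (length-filter-¬ (v ∈ᵗ?_) E))) E≤9))

  sep : ∀ {t} → t ∈ rest → ∀ {k l} → k ≢ l →
    BicolouredOn (hubbed k ∘ φ) t ⊎ BicolouredOn (hubbed l ∘ φ) t
  sep {t} t∈rest = hubbed-separates (φ (t 0F)) (off 0F) (φ (t 1F)) (off 1F) (φ (t 2F)) (off 2F)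
    (λ eq → contradiction (t-inj (φ-inj eq)) λ ())
    (λ eq → contradiction (t-inj (φ-inj eq)) λ ())
    (λ eq → contradiction (t-inj (φ-inj eq)) λ ()) _ _
    where
    t-inj = inj (proj₁ (∈-filter⁻ (¬? ∘ (v ∈ᵗ?_)) {xs = E} t∈rest))
    off : ∀ i → φ (t i) ≢ zero
    off i eq = proj₂ (∈-filter⁻ (¬? ∘ (v ∈ᵗ?_)) {xs = E} t∈rest) (i , φ-inj (trans eq (sym φv)))

  good-star : ∀ c {t} → t ∈ star → BicolouredOn (hubbed c ∘ φ) t
  good-star c t∈star =
    let k = index t∈star
        l , φt = φ-star k
    in subst (BicolouredOn (hubbed c ∘ φ)) (sym (lookup-index t∈star))
      (bicolouredOn-resp (hubbed c) {φ} {lookup star k} φt (hubbed-spokes c (proj₁ (hub k)) l))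

-- Double counting of degrees

𝟙 : ∀ {A : Set} → Dec A → ℕ
𝟙 P? = if does P? then 1 else 0

sum-mono-≤ : ∀ {n} {f g : Fin n → ℕ} → (∀ i → f i ≤ g i) → sum f ≤ sum g
sum-mono-≤ {zero}  f≤g = z≤n
sum-mono-≤ {suc n} f≤g = ℕ.+-mono-≤ (f≤g zero) (sum-mono-≤ (f≤g ∘ suc))

*≤sum : ∀ {n k} {f : Fin n → ℕ} → (∀ i → k ≤ f i) → n * k ≤ sum f
*≤sum {zero}  k≤f = z≤n
*≤sum {suc n} k≤f = ℕ.+-mono-≤ (k≤f zero) (*≤sum (k≤f ∘ suc))

𝟙-any?≤sum : ∀ {n} {P : Fin n → Set} (P? : ∀ i → Dec (P i)) → 𝟙 (any? P?) ≤ sum (𝟙 ∘ P?)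
𝟙-any?≤sum {zero}  P? = z≤n
𝟙-any?≤sum {suc n} P? with does (P? zero)
... | true  = s≤s z≤n
... | false = 𝟙-any?≤sum (P? ∘ suc)

sum-𝟙-≟ : ∀ {n} (x : Fin n) → sum (λ v → 𝟙 (x Fin.≟ v)) ≡ 1
sum-𝟙-≟ {suc n} zero = cong suc (sum-replicate-zero ℕ.+-0-commutativeMonoid n)
sum-𝟙-≟ (suc x) = sum-𝟙-≟ x

-- Swapping the sums counts the three positions instead of vertices; this is an upper bound because
-- a vertex may fill several positions.
sum-𝟙-∈ᵗ : ∀ {n} (t : Triple n) → sum (λ v → 𝟙 (v ∈ᵗ? t)) ≤ 3
sum-𝟙-∈ᵗ t = begin
  sum (λ v → 𝟙 (v ∈ᵗ? t))                    ≤⟨ sum-mono-≤ (λ v → 𝟙-any?≤sum (λ i → t i Fin.≟ v)) ⟩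
  sum (λ v → sum (λ i → 𝟙 (t i Fin.≟ v)))    ≡⟨ ∑-comm ℕ.+-0-commutativeMonoid (λ v i → 𝟙 (t i Fin.≟ v)) ⟩
  sum (λ i → sum (λ v → 𝟙 (t i Fin.≟ v)))    ≤⟨ sum-mono-≤ (λ i → ℕ.≤-reflexive (sum-𝟙-≟ (t i))) ⟩
  3                                          ∎
  where open ℕ.≤-Reasoning

degree-∷ : ∀ {n} (v : Fin n) t E → degree v (t ∷ E) ≡ 𝟙 (v ∈ᵗ? t) + degree v E
degree-∷ v t E with does (v ∈ᵗ? t)
... | true  = refl
... | false = refl

sum-degree : ∀ {n} (E : List (Triple n)) → sum (λ v → degree v E) ≤ length E * 3
sum-degree {n} [] = ℕ.≤-reflexive (sum-replicate-zero ℕ.+-0-commutativeMonoid n)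
sum-degree (t ∷ E) = begin
  sum (λ v → degree v (t ∷ E))                           ≤⟨ sum-mono-≤ (λ v → ℕ.≤-reflexive (degree-∷ v t E)) ⟩
  sum (λ v → 𝟙 (v ∈ᵗ? t) + degree v E)                   ≡⟨ ∑-distrib-+ ℕ.+-0-commutativeMonoid (λ v → 𝟙 (v ∈ᵗ? t)) (λ v → degree v E) ⟩
  sum (λ v → 𝟙 (v ∈ᵗ? t)) + sum (λ v → degree v E)       ≤⟨ ℕ.+-mono-≤ (sum-𝟙-∈ᵗ t) (sum-degree E) ⟩
  3 + length E * 3                                       ∎
  where open ℕ.≤-Reasoning

-- Were all degrees at least 4, their sum would be at least 28, but it is at most 27.
low-degree-vertex : ∀ {n} (E : List (Triple n)) → length E ≤ 9 → 7 ≤ n → ∃ λ v → degree v E ≤ 3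
low-degree-vertex E E≤9 7≤n with any? (λ v → degree v E ℕ.≤? 3)
... | yes found = found
... | no none = contradiction
  (ℕ.≤-trans (ℕ.*-monoˡ-≤ 4 7≤n) (ℕ.≤-trans (*≤sum (λ v → ℕ.≰⇒> (none ∘ (v ,_))))
    (ℕ.≤-trans (sum-degree E) (ℕ.*-monoˡ-≤ 3 E≤9))))
  (ℕ.<⇒≱ (ℕ.n<1+n 27))

-- Merging two vertices and the induction

-- `punchOut v≢w` is the name of `w` once `v` is deleted, so `v` is sent to where `w` goes.
merge : ∀ {n} {v w : Fin (suc n)} → v ≢ w → Fin (suc n) → Fin n
merge {v = v} v≢w x with v Fin.≟ x
... | yes _  = punchOut v≢w
... | no v≢x = punchOut v≢x

merge-injective : ∀ {n} {v w : Fin (suc n)} (v≢w : v ≢ w) {x y} → merge v≢w x ≡ merge v≢w y →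
  x ≡ y ⊎ (v ≡ x × w ≡ y) ⊎ (v ≡ y × w ≡ x)
merge-injective {v = v} v≢w {x} {y} eq with v Fin.≟ x | v Fin.≟ y
... | yes refl | yes refl = inj₁ refl
... | yes v≡x  | no v≢y   = inj₂ (inj₁ (v≡x , punchOut-injective v≢w v≢y eq))
... | no v≢x   | yes v≡y  = inj₂ (inj₂ (v≡y , punchOut-injective v≢w v≢x (sym eq)))
... | no v≢x   | no v≢y   = inj₁ (punchOut-injective v≢x v≢y eq)

-- After embedding the vertices into six points, the ten `balanced` colourings outnumber the edges.
small-colourable : ∀ {n} (E : List (Triple n)) → All-Inj E → length E ≤ 9 → n ≤ 6 → HasBicolouring E
small-colourable E inj E≤9 n≤6 =
  let k , good = pigeonhole-colouring (λ k → balanced k ∘ ι) E (s≤s E≤9) sep in balanced k ∘ ι , good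
  where
  ι = λ x → inject≤ x n≤6
  ι-inj : Inj ι
  ι-inj = inject≤-injective n≤6 n≤6 _ _
  sep : ∀ {t} → t ∈ E → ∀ {k l} → k ≢ l →
    BicolouredOn (balanced k ∘ ι) t ⊎ BicolouredOn (balanced l ∘ ι) t
  sep {t} t∈E = balanced-separates (ι (t 0F)) (ι (t 1F)) (ι (t 2F))
    (λ eq → contradiction (inj t∈E (ι-inj eq)) λ ())
    (λ eq → contradiction (inj t∈E (ι-inj eq)) λ ())
    (λ eq → contradiction (inj t∈E (ι-inj eq)) λ ()) _ _

-- Merging lowers the number of vertices and keeps the length of the list, even if edges become
-- equal; a colouring of the merged list pulls back along `g`.
colourable : ∀ {n} (E : List (Triple n)) → All-Inj E → length E ≤ 9 → HasBicolouring E
colourable {n} E inj E≤9 with n ℕ.≤? 6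
colourable {n} E inj E≤9 | yes n≤6 = small-colourable E inj E≤9 n≤6
colourable {zero} E inj E≤9 | no 0≰6 = contradiction z≤n 0≰6
colourable {suc n} E inj E≤9 | no n≰6
  with v , d≤3 ← low-degree-vertex E E≤9 (ℕ.≰⇒> n≰6)
  with any? (λ w → ¬? (w Fin.≟ v) ×-dec ¬? (Any.any? (λ t → (v ∈ᵗ? t) ×-dec (w ∈ᵗ? t)) E))
... | no all-covered = covered-colourable E inj E≤9 (ℕ.≰⇒> n≰6) v d≤3 λ w w≢v →
  decidable-stable (Any.any? (λ t → (v ∈ᵗ? t) ×-dec (w ∈ᵗ? t)) E) λ uncovered →
  all-covered (w , w≢v , uncovered)
... | yes (w , w≢v , uncovered) =
  let f , good = colourable (map (g ∘_) E) g-inj (ℕ.≤-trans (ℕ.≤-reflexive (length-map _ E)) E≤9)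
  in f ∘ g , All.map⁻ good
  where
  g = merge (w≢v ∘ sym)
  -- Two corners of a triple can collide only if they are `v` and `w`, which no triple contains
  -- together.
  g-inj : All-Inj (map (g ∘_) E)
  g-inj t∈ {i} {j} eq with ∈-map⁻ (g ∘_) t∈
  ... | t , t∈E , refl with merge-injective (w≢v ∘ sym) eq
  ... | inj₁ ti≡tj = inj t∈E ti≡tj
  ... | inj₂ (inj₁ (v≡ , w≡)) = contradiction (lose t∈E ((i , sym v≡) , (j , sym w≡))) uncovered
  ... | inj₂ (inj₂ (v≡ , w≡)) = contradiction (lose t∈E ((j , sym v≡) , (i , sym w≡))) uncovered

-- From edges as subsets to triples

-- The case split follows `deduplicate`, which treats the tail first: `b ≟ c` comes before the
-- comparisons with `a`.
length-dedup₃ : ∀ {A : Set} (_≟_ : DecidableEquality A) {a b c : A} →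
  Bicoloured a b c →
  length (deduplicate _≟_ (a ∷ b ∷ c ∷ [])) ≡ 2
length-dedup₃ _≟_ {a} {b} {c} p with b ≟ c
length-dedup₃ _≟_ {a} {b} p | yes refl with a ≟ b
length-dedup₃ _≟_ (inj₁ a≢b , _) | yes refl | yes a≡b = contradiction a≡b a≢b
length-dedup₃ _≟_ (inj₂ a≢b , _) | yes refl | yes a≡b = contradiction a≡b a≢b
... | no _ = refl
length-dedup₃ _≟_ {a} {b} {c} p | no b≢c with a ≟ b
length-dedup₃ _≟_ {a} {b} {c} p | no b≢c | yes a≡b with a ≟ c
... | yes a≡c = contradiction (trans (sym a≡b) a≡c) b≢c
... | no _    = refl
length-dedup₃ _≟_ {a} {b} {c} p | no b≢c | no a≢b with a ≟ c
... | yes _ = refl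
length-dedup₃ _≟_ (_ , inj₁ a≡b) | no b≢c | no a≢b | no a≢c = contradiction a≡b a≢b
length-dedup₃ _≟_ (_ , inj₂ (inj₁ a≡c)) | no b≢c | no a≢b | no a≢c = contradiction a≡c a≢c
length-dedup₃ _≟_ (_ , inj₂ (inj₂ b≡c)) | no b≢c | no a≢b | no a≢c = contradiction b≡c b≢c

dedup₃-bicoloured : ∀ {A : Set} (_≟_ : DecidableEquality A) (a b c : A) →
  let l = length (deduplicate _≟_ (a ∷ b ∷ c ∷ [])) in 1 < l → l < 3 →
  Bicoloured a b c
dedup₃-bicoloured _≟_ a b c 1<l l<3 with b ≟ c
dedup₃-bicoloured _≟_ a b c 1<l l<3 | yes b≡c with a ≟ b
dedup₃-bicoloured _≟_ a b c (s≤s ()) l<3 | yes b≡c | yes a≡b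
... | no a≢b = inj₁ a≢b , inj₂ (inj₂ b≡c)
dedup₃-bicoloured _≟_ a b c 1<l l<3 | no b≢c with a ≟ b
... | yes a≡b = inj₂ (b≢c ∘ trans (sym a≡b)) , inj₁ a≡b
dedup₃-bicoloured _≟_ a b c 1<l l<3 | no b≢c | no a≢b with a ≟ c
... | yes a≡c = inj₁ a≢b , inj₂ (inj₁ a≡c)
dedup₃-bicoloured _≟_ a b c 1<l (s≤s (s≤s (s≤s ()))) | no b≢c | no a≢b | no a≢c

-- Stated for an arbitrary `g` because the induction passes to `g ∘ suc`; the case of interest is
-- `elems`.
length-filter-tabulate : ∀ {m} {A : Set} {P : A → Set} (P? : ∀ x → Dec (P x)) (p : Subset m) (g : Fin m → A) →
  (∀ {i} → P (g i) → i ∈ˢ p) → (∀ {i} → i ∈ˢ p → P (g i)) →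
  length (filter P? (List.tabulate g)) ≡ ∣ p ∣
length-filter-tabulate P? [] g to from = refl
length-filter-tabulate P? (s ∷ p) g to from
  with ih ← length-filter-tabulate P? p (g ∘ suc) (drop-there ∘ to) (from ∘ there)
  with P? (g zero) | s
... | yes _ | true  = cong suc ih
... | yes P₀ | false = contradiction (to P₀) λ ()
... | no ¬P₀ | true = contradiction (from here) ¬P₀
... | no _ | false = ih

triple-of : ∀ {n} (e : Subset n) → ∣ e ∣ ≡ 3 →
  Σ (Triple n) λ t → Inj t × elems e ≡ t 0F ∷ t 1F ∷ t 2F ∷ []
triple-of {n} e ∣e∣≡3 = from-list (elems e)
  (trans (length-filter-tabulate (_∈? e) e id id id) ∣e∣≡3) (filter⁺ (_∈? e) (allFin⁺ n))
  where
  from-list : ∀ xs → length xs ≡ 3 → Unique xs →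
    Σ (Triple n) λ t → Inj t × xs ≡ t 0F ∷ t 1F ∷ t 2F ∷ []
  from-list (x ∷ y ∷ z ∷ []) refl ((x≢y ∷ x≢z ∷ []) ∷ (y≢z ∷ []) ∷ [] ∷ []) = t , inj , refl
    where
    t : Triple n
    t 0F = x
    t 1F = y
    t 2F = z
    inj : Inj t
    inj {0F} {0F} _ = refl
    inj {0F} {1F} eq = contradiction eq x≢y
    inj {0F} {2F} eq = contradiction eq x≢z
    inj {1F} {0F} eq = contradiction (sym eq) x≢y
    inj {1F} {1F} _ = refl
    inj {1F} {2F} eq = contradiction eq y≢z
    inj {2F} {0F} eq = contradiction (sym eq) x≢z
    inj {2F} {1F} eq = contradiction (sym eq) y≢z
    inj {2F} {2F} _ = refl

≤9-colourable : ∀ {n} (H : BiHypergraph n) → Uniform 3 H → numEdges H ≤ 9 → Colourable H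
≤9-colourable {n} H uni E≤9 = proj₁ colouring , proper
  where
  tripleAt : ∀ {e} → e ∈ E (pre H) → Triple n
  tripleAt {e} e∈E = proj₁ (triple-of e (uni e∈E))

  triples : List (Triple n)
  -- Ordering an edge as a triple needs a proof that its size is 3, which `uni` gives only for
  -- members.
  triples = mapWith∈ (E (pre H)) tripleAt

  inj : All-Inj triples
  inj t∈ with mapWith∈⁻ (E (pre H)) tripleAt t∈
  ... | e , e∈E , refl = proj₁ (proj₂ (triple-of e (uni e∈E)))

  colouring : HasBicolouring triples
  colouring = colourable triples inj
    (ℕ.≤-trans (ℕ.≤-reflexive (length-mapWith∈ (≡.setoid _) (E (pre H)))) E≤9)

  proper : ProperColouring (E (pre H)) (proj₁ colouring)
  proper {e} e∈E = subst (1 <_) (sym two) ℕ.≤-refl , ℕ.≤-reflexive (trans (cong suc two) (sym (uni e∈E)))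
    where
    f = proj₁ colouring
    two : colours f e ≡ 2
    two = trans (cong (λ xs → length (deduplicate ℕ._≟_ (map f xs))) (proj₂ (proj₂ (triple-of e (uni e∈E)))))
      (length-dedup₃ ℕ._≟_ (All.lookup (proj₂ colouring) (mapWith∈⁺ tripleAt (e , e∈E , refl))))

-- The complete 3-uniform hypergraph on five vertices

-- The second argument is the size of the subsets; the recursion is Pascal's rule.
subsets : ∀ n → ℕ → List (Subset n)
subsets zero    zero    = [] ∷ []
subsets zero    (suc k) = []
subsets (suc n) zero    = ⊥ ∷ []
subsets (suc n) (suc k) = map (inside ∷_) (subsets n k) ++ map (outside ∷_) (subsets n (suc k))

K : List (Subset 5)
K = subsets 5 3

_≟ˢ_ : ∀ {n} → DecidableEquality (Subset n)
_≟ˢ_ = ≡-dec Bool._≟_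

indicator : ∀ {n} → Subset n → Fin n → ℕ
indicator e x = 𝟙 (x ∈? e)

abstract
  K-unique : Unique K
  K-unique = from-yes (unique? _≟ˢ_ K)

  K-uniform : All (λ e → ∣ e ∣ ≡ 3) K
  K-uniform = from-yes (All.all? (λ e → ∣ e ∣ ℕ.≟ 3) K)

  K-sperner : All (λ e → All (λ e′ → e ⊆ e′ → e ≡ e′) K) K
  K-sperner = from-yes (All.all? (λ e → All.all? (λ e′ → (e ⊆? e′) →-dec (e ≟ˢ e′)) K) K)

  K-covers : ∀ v → Any (v ∈ˢ_) K
  K-covers = from-yes (all? λ v → Any.any? (v ∈?_) K)

  K-complete : ∀ i j k → i Fin.< j → j Fin.< k → Any (λ e → elems e ≡ i ∷ j ∷ k ∷ []) K
  K-complete = from-yes (all? λ i → all? λ j → all? λ k → (i Fin.<? j) →-dec (j Fin.<? k) →-dec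
    Any.any? (λ e → List.≡-dec Fin._≟_ (elems e) (i ∷ j ∷ k ∷ [])) K)

  -- The colour classes are `e` and its two-element complement, so `e` is the only monochromatic
  -- triple.
  indicator-proper : All (λ e → All (λ e′ → e′ ≢ e →
    (1 < colours (indicator e) e′) × (colours (indicator e) e′ < ∣ e′ ∣)) K) K
  indicator-proper = from-yes (All.all? (λ e → All.all? (λ e′ → ¬? (e′ ≟ˢ e) →-dec
    (1 ℕ.<? colours (indicator e) e′) ×-dec (colours (indicator e) e′ ℕ.<? ∣ e′ ∣)) K) K)

Monochromatic₃ : ∀ {n} → Vec Bool n → Set
Monochromatic₃ {n} s = Σ (Fin n) λ i → Σ (Fin n) λ j → Σ (Fin n) λ k → i Fin.< j × j Fin.< k ×
  Vec.lookup s i ≡ Vec.lookup s j × Vec.lookup s i ≡ Vec.lookup s k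

monochromatic₃? : ∀ {n} (s : Vec Bool n) → Dec (Monochromatic₃ s)
monochromatic₃? s = any? λ i → any? λ j → any? λ k → (i Fin.<? j) ×-dec (j Fin.<? k) ×-dec
  (Vec.lookup s i Bool.≟ Vec.lookup s j) ×-dec (Vec.lookup s i Bool.≟ Vec.lookup s k)

abstract
  -- A `Subset 5` is a `Vec Bool 5`, so a search over all subsets rules out a counterexample.
  two-colours-of-five : (s : Vec Bool 5) → Monochromatic₃ s
  two-colours-of-five s = decidable-stable (monochromatic₃? s) λ ¬m →
    from-no (anySubset? {n = 5} (¬? ∘ monochromatic₃?)) (s , ¬m)

bicoloured-triples : ∀ {f : Fin 5 → ℕ} → ProperColouring K f → ∀ {i j k} → i Fin.< j → j Fin.< k →
  Bicoloured (f i) (f j) (f k)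
bicoloured-triples {f} proper {i} {j} {k} i<j j<k
  with e , e∈K , eq ← find (K-complete i j k i<j j<k)
  with 1<c , c<∣e∣ ← proper e∈K
  rewrite All.lookup K-uniform e∈K | eq = dedup₃-bicoloured ℕ._≟_ (f i) (f j) (f k) 1<c c<∣e∣

-- Some `f j` differs from `f 0F`. No triple on `0F` and `j` is rainbow, so every vertex has one of
-- these two colours, and three of the five vertices then agree.
K-uncolourable : (f : Fin 5 → ℕ) → ¬ ProperColouring K f
K-uncolourable f proper = second-colour (any? (λ j → ¬? (f 0F ℕ.≟ f j)))
  where
  bicoloured : ∀ {i j k} → i Fin.< j → j Fin.< k → Bicoloured (f i) (f j) (f k)
  bicoloured = bicoloured-triples proper

  second-colour : ¬ Dec (∃ λ j → f 0F ≢ f j)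
  second-colour (no none) with bicoloured {0F} {1F} {2F} (s≤s z≤n) (s≤s (s≤s z≤n))
  ... | inj₁ f₀≢f₁ , _ = none (1F , f₀≢f₁)
  ... | inj₂ f₀≢f₂ , _ = none (2F , f₀≢f₂)
  second-colour (yes (j , f₀≢fⱼ)) = refute (two-colours-of-five sides)
    where
    colour : Bool → ℕ
    colour b = if b then f 0F else f j

    0<j : ∀ {j} → f 0F ≢ f j → Fin._<_ {5} 0F j
    0<j {zero}  f₀≢f₀ = contradiction refl f₀≢f₀
    0<j {suc j} _     = s≤s z≤n

    side : ∀ k → ∃ λ b → f k ≡ colour b
    side zero = true , refl
    -- `bicoloured` takes its vertices in increasing order, hence the comparison of `j` with
    -- `suc k`.
    side (suc k) with <-cmp j (suc k)
    ... | tri≈ _ refl _ = false , refl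
    ... | tri< j<k _ _ with proj₂ (bicoloured (0<j f₀≢fⱼ) j<k)
    ...   | inj₁ f₀≡fⱼ        = contradiction f₀≡fⱼ f₀≢fⱼ
    ...   | inj₂ (inj₁ f₀≡fₖ) = true , sym f₀≡fₖ
    ...   | inj₂ (inj₂ fⱼ≡fₖ) = false , sym fⱼ≡fₖ
    side (suc k) | tri> _ _ k<j with proj₂ (bicoloured {0F} (s≤s z≤n) k<j)
    ...   | inj₁ f₀≡fₖ        = true , sym f₀≡fₖ
    ...   | inj₂ (inj₁ f₀≡fⱼ) = contradiction f₀≡fⱼ f₀≢fⱼ
    ...   | inj₂ (inj₂ fₖ≡fⱼ) = false , fₖ≡fⱼ

    sides : Vec Bool 5
    sides = Vec.tabulate (proj₁ ∘ side)

    colour-by-side : ∀ k → f k ≡ colour (Vec.lookup sides k)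
    colour-by-side k = trans (proj₂ (side k)) (cong colour (sym (lookup∘tabulate (proj₁ ∘ side) k)))

    same : ∀ {k l} → Vec.lookup sides k ≡ Vec.lookup sides l → f k ≡ f l
    same {k} {l} eq = trans (colour-by-side k) (trans (cong colour eq) (sym (colour-by-side l)))

    refute : ¬ Monochromatic₃ sides
    refute (i , k , l , i<k , k<l , i≡k , i≡l) with proj₁ (bicoloured i<k k<l)
    ... | inj₁ fᵢ≢fₖ = fᵢ≢fₖ (same i≡k)
    ... | inj₂ fᵢ≢fₗ = fᵢ≢fₗ (same i≡l)

K-hypergraph : BiHypergraph 5
K-hypergraph = mkBi (mkPre ⊤ K K-unique (λ _ → ⊆⊤)) λ e∈K e′∈K → All.lookup (All.lookup K-sperner e∈K) e′∈K

-- A subhypergraph with all the edges also has all the vertices, since the edges cover them, so a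
-- proper one misses some edge `e`; then `indicator e` colours it.
K-minimal : MinimalUncolourable K-hypergraph
K-minimal = (λ (f , proper) → K-uncolourable f proper) , critical
  where
  critical : ∀ H′ → SubHypergraph H′ (pre K-hypergraph) → Proper H′ (pre K-hypergraph) → ColourablePre H′
  critical H′ (_ , E′⊆K) proper with All.all? (λ e → Any.any? (e ≟ˢ_) (E H′)) K
  ... | yes K⊆E′ = contradiction ((λ {v} _ → spans v) , λ {e} → All.lookup K⊆E′ {e}) proper
    where
    spans : ∀ v → v ∈ˢ V H′
    spans v = let e , e∈K , v∈e = find (K-covers v) in E⊆V H′ (All.lookup K⊆E′ e∈K) v∈e
  ... | no K⊈E′ =
    let e , e∈K , e∉E′ = find (All.¬All⇒Any¬ (λ e → Any.any? (e ≟ˢ_) (E H′)) K K⊈E′)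
    in indicator e , λ {e′} e′∈E′ → All.lookup (All.lookup indicator-proper e∈K) (E′⊆K e′∈E′)
      λ e′≡e → e∉E′ (subst (_∈ E H′) e′≡e e′∈E′)

theorem1p2 : (Σ ℕ λ n → Σ (BiHypergraph n) λ H → Uniform 3 H × MinimalUncolourable H × numEdges H ≡ 10)
    × (∀ n (H : BiHypergraph n) → Uniform 3 H → MinimalUncolourable H → 0 < numEdges H → 10 ≤ numEdges H)
theorem1p2 = (5 , K-hypergraph , All.lookup K-uniform , K-minimal , refl) ,
  λ n H uni (uncolourable , _) _ → ℕ.≰⇒> λ E≤9 → uncolourable (≤9-colourable H uni E≤9)
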